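{- For every generalized line graph $G$, the competition number satisfies $k(G)\le 2$.
   Context: All graphs are finite and simple. For a digraph $D$, its competition graph $C(D)$ is the graph with vertex set $V(D)$ in which two distinct vertices $u,v$ are adjacent iff there is a vertex $x$ with arcs $(u,x),(v,x)\in A(D)$. The competition number $k(G)$ of a graph $G$ is the smallest nonnegative integer $k$ such that $G$ together with $k$ new isolated vertices is the competition graph of an acyclic digraph. For a positive integer $m$, the cocktail party graph $CP(m)$ is the complete multipartite graph with $m$ parts each of size two (vertices $x_l,y_l$, $l\in\{1,\dots,m\}$; $x_i x_j$, $y_iy_j$ adjacent for $i<j$, $x_iy_j$ adjacent for $i\ne j$); $CP(1)$ is two vertices with no edge. A vertex-weighted graph $(H,f)$ is a graph $H$ with a function $f:V(H)\to\mathbb{Z}_{\ge 0}$. The generalized line graph $L(H,f)$ is obtained from the disjoint union of the line graph $L(H)$ (vertex set $E(H)$, two distinct edges adjacent iff they share an endpoint) and the graphs $Q_v:=CP(f(v))$ for each $v\in V(H)$ with $f(v)>0$, by adding all edges between every vertex of $Q_v$ and every $e\in V(L(H))$ that is incident to $v$ in $H$. A graph is a generalized line graph if it is isomorphic to $L(H,f)$ for some vertex-weighted graph $(H,f)$. -}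

module Defs where

open import Data.Bool using (Bool)
open import Data.Fin using (Fin; _<_)
open import Data.Nat using (ℕ; _≤_)
open import Data.Product using (Σ; ∃; ∃-syntax; _×_; _,_)
open import Data.Sum using (_⊎_; inj₁; inj₂)
open import Function.Base using (_∘_)
open import Function.Bundles using (_↔_; _⇔_; module Inverse)
open import Level using (0ℓ)
open import Relation.Binary.Construct.Closure.Transitive using (TransClosure)
open import Relation.Binary.Core using (Rel)
open import Relation.Binary.Definitions using (Symmetric; Irreflexive; Decidable)
open import Relation.Binary.PropositionalEquality using (_≡_; _≢_; refl; sym)
open import Relation.Nullary using (¬_)

record Graph (V : Set) : Set₁ where
  field
    Adj    : Rel V 0ℓ
    symm   : Symmetric Adj
    irrefl : Irreflexive _≡_ Adj

open Graph

-- Constructively, a finite edge set means that adjacency is decidable.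
record FiniteGraph : Set₁ where
  field
    order : ℕ
    graph : Graph (Fin order)
    adj?  : Decidable (Adj graph)

open FiniteGraph

record Digraph (V : Set) : Set₁ where
  field
    Arc  : Rel V 0ℓ
    arc? : Decidable Arc

open Digraph

-- Equality of graphs on a common vertex set.
_≈_ : {V : Set} → Graph V → Graph V → Set
G ≈ H = ∀ u v → Adj G u v ⇔ Adj H u v

record _≅_ {V W : Set} (G : Graph V) (H : Graph W) : Set where
  field
    bijection : V ↔ W
    preserves : ∀ u v → Adj G u v ⇔ Adj H (Inverse.to bijection u) (Inverse.to bijection v)

infix 4 _≈_ _≅_

-- The digraph has no directed closed walk of positive length; in particular no loops.
Acyclic : {V : Set} → Digraph V → Set
Acyclic D = ∀ v → ¬ TransClosure (Arc D) v v

competitionGraph : {V : Set} → Digraph V → Graph V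
competitionGraph D = record
  { Adj    = λ u v → u ≢ v × ∃[ x ] (Arc D u x × Arc D v x)
  ; symm   = λ { (u≢v , x , ux , vx) → u≢v ∘ sym , x , vx , ux }
  ; irrefl = λ { u≡v (u≢v , _) → u≢v u≡v }
  }

data WithIsolatedAdj {V : Set} (G : Graph V) (k : ℕ) : Rel (V ⊎ Fin k) 0ℓ where
  old : ∀ {u v} → Adj G u v → WithIsolatedAdj G k (inj₁ u) (inj₁ v)

withIsolated : {V : Set} → Graph V → (k : ℕ) → Graph (V ⊎ Fin k)
withIsolated G k = record
  { Adj    = WithIsolatedAdj G k
  ; symm   = λ { (old uv) → old (symm G uv) }
  ; irrefl = λ { refl (old uv) → irrefl G refl uv }
  }

IsAcyclicCompetitionGraph : {V : Set} → Graph V → Set₁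
IsAcyclicCompetitionGraph {V} G =
  Σ (Digraph V) λ D → Acyclic D × (G ≈ competitionGraph D)

IsCompetitionNumber : FiniteGraph → ℕ → Set₁
IsCompetitionNumber G k =
  IsAcyclicCompetitionGraph (withIsolated (graph G) k) ×
  (∀ j → IsAcyclicCompetitionGraph (withIsolated (graph G) j) → k ≤ j)

-- The two vertices x_l , y_l of the part l are (l , true) and (l , false).
CPVertex : ℕ → Set
CPVertex m = Fin m × Bool

cocktailParty : (m : ℕ) → Graph (CPVertex m)
cocktailParty m = record
  { Adj    = λ { (i , _) (j , _) → i ≢ j }
  ; symm   = λ i≢j → i≢j ∘ sym
  ; irrefl = λ { refl i≢i → i≢i refl }
  }

-- An unordered pair of adjacent vertices, listed in increasing order. The
-- proofs are irrelevant so that an edge is determined by its endpoints.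
record Edge {n : ℕ} (H : Graph (Fin n)) : Set where
  constructor edge
  field
    lo hi  : Fin n
    .lo<hi : lo < hi
    .adj   : Adj H lo hi

_∈ₑ_ : {n : ℕ} {H : Graph (Fin n)} → Fin n → Edge H → Set
v ∈ₑ e = v ≡ Edge.lo e ⊎ v ≡ Edge.hi e

infix 4 _∈ₑ_

lineGraph : {n : ℕ} (H : Graph (Fin n)) → Graph (Edge H)
lineGraph H = record
  { Adj    = λ d e → d ≢ e × ∃[ v ] (v ∈ₑ d × v ∈ₑ e)
  ; symm   = λ { (d≢e , v , v∈d , v∈e) → d≢e ∘ sym , v , v∈e , v∈d }
  ; irrefl = λ { d≡e (d≢e , _) → d≢e d≡e }
  }

-- (v , q) is the vertex q of Q_v; there is none when f v = 0.
GLVertex : {n : ℕ} (H : Graph (Fin n)) (f : Fin n → ℕ) → Set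
GLVertex {n} H f = Edge H ⊎ Σ (Fin n) λ v → CPVertex (f v)

data GLAdj {n : ℕ} (H : Graph (Fin n)) (f : Fin n → ℕ) : Rel (GLVertex H f) 0ℓ where
  line    : ∀ {d e} → Adj (lineGraph H) d e → GLAdj H f (inj₁ d) (inj₁ e)
  party   : ∀ {v p q} → Adj (cocktailParty (f v)) p q → GLAdj H f (inj₂ (v , p)) (inj₂ (v , q))
  cross   : ∀ {v q e} → v ∈ₑ e → GLAdj H f (inj₂ (v , q)) (inj₁ e)
  cross⁻¹ : ∀ {v q e} → v ∈ₑ e → GLAdj H f (inj₁ e) (inj₂ (v , q))

generalizedLineGraph : {n : ℕ} (H : Graph (Fin n)) (f : Fin n → ℕ) → Graph (GLVertex H f)
generalizedLineGraph H f = record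
  { Adj    = GLAdj H f
  ; symm   = λ { (line de) → line (symm (lineGraph H) de)
               ; (party {v} {p} {q} pq) → party (symm (cocktailParty (f v)) {p} {q} pq)
               ; (cross v∈e) → cross⁻¹ v∈e
               ; (cross⁻¹ v∈e) → cross v∈e }
  ; irrefl = λ { refl (line dd) → irrefl (lineGraph H) refl dd
               ; refl (party {v} {p} pp) → irrefl (cocktailParty (f v)) {p} refl pp }
  }

IsGeneralizedLineGraph : FiniteGraph → Set₁
IsGeneralizedLineGraph G =
  Σ FiniteGraph λ H → Σ (Fin (order H) → ℕ) λ f →
    graph G ≅ generalizedLineGraph (graph H) f

{-# OPTIONS --safe #-}

-- An edge clique cover of G is made into the predator sets of an acyclic digraph, each clique getting a prey that
-- comes after all its members. In a line graph the cliques are the stars of H; if the edges of H are added so that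
-- a component is exhausted along connected edge sets, then every new edge pays for the new star it creates, and two
-- extra vertices suffice. The graphs Q_v = CP(f(v)) are then glued on one at a time: CP(m) has a realization with
-- two extra vertices in which two vertices of CP(m) are the prey of nobody. These two replace the two extra
-- vertices used so far, and the star of v joins all the other cliques of CP(m).
-- This bounds the competition number; that it exists constructively is a finite search, in which acyclicity is
-- decided by looking for a nonempty set of vertices each having an out-neighbour in the set.
module Submission where

open import Defs
open import Data.Nat using (_≤_)
open import Data.Product using (∃-syntax; _×_)
open import Data.Bool using (Bool; true; false)
import Data.Bool.Properties as Bool
open import Data.Empty using (⊥; ⊥-elim; ⊥-elim-irr)
open import Data.Fin as Fin using (Fin; zero; suc; toℕ; fromℕ; combine; remQuot)
open import Data.Fin.Induction using (spo-wellFounded)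
open import Data.Fin.Properties as Fin using (_≟_; any?; toℕ<n; toℕ-fromℕ; remQuot-combine; +↔⊎)
open import Data.Fin.Subset using (Subset; Nonempty; ⁅_⁆; _∪_) renaming (_∈_ to _∈ˢ_)
open import Data.Fin.Subset.Properties using (anySubset?; nonempty?; x∈⁅x⁆; x∈⁅y⁆⇒x≡y; x∈p∪q⁺; x∈p∪q⁻) renaming (_∈?_ to _∈ˢ?_)
open import Data.List using (List; []; _∷_; concatMap; cartesianProduct; allFin; filter; length)
import Data.List.Properties as List
open import Data.List.Membership.Propositional using (_∈_; _∉_; find; lose)
open import Data.List.Membership.Propositional.Properties using (∈-concatMap⁺; ∈-cartesianProduct⁺; ∈-allFin; ∈-filter⁺; ∈-filter⁻)
open import Data.List.Relation.Unary.Any as Any using (Any; here)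
open import Data.Maybe using (Maybe; just; nothing)
import Data.Maybe.Properties as Maybe
open import Data.Nat as ℕ using (ℕ; zero; suc; _*_; _<_; z≤n; s≤s; z<s; _<?_)
open import Data.Nat.Induction using (<-wellFounded)
open import Data.Nat.Properties as ℕ using (≤-refl)
open import Data.Product using (Σ; ∃; _,_; proj₁; proj₂; uncurry)
import Data.Product.Properties as Product
open import Data.Sum as Sum using (_⊎_; inj₁; inj₂)
import Data.Sum.Properties as Sum
open import Data.Unit using (⊤; tt)
open import Data.Vec using (tabulate)
open import Data.Vec.Properties using (lookup∘tabulate; lookup⇒[]=; []=⇒lookup)
open import Function using (_∘_; id; flip; _⇔_; _↔_; mk⇔; mk↔ₛ′; Equivalence; Injection; Inverse)
open import Function.Construct.Identity using (↔-id)
open import Function.Properties.Inverse using (↔-sym; ↔⇒↣)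
open import Induction.WellFounded using (Acc; acc; WellFounded; module Subrelation)
open import Level using (0ℓ)
open import Relation.Binary as B using (Rel; DecidableEquality; IsStrictPartialOrder; tri<; tri≈; tri>)
open import Relation.Binary.Construct.Closure.Transitive using (TransClosure; [_]; _∷_; _∷ʳ_; _++_)
import Relation.Binary.Construct.On as On
open import Relation.Binary.PropositionalEquality
  using (_≡_; _≢_; refl; sym; trans; cong; cong₂; subst; subst₂; isEquivalence)
open import Relation.Nullary using (¬_; Dec; yes; no; does; contradiction)
open import Relation.Nullary.Decidable using (map′; dec-true; decidable-stable; _×-dec_; _⊎-dec_; _→-dec_; ¬?)
open import Relation.Unary using (Decidable; Pred)

open Graph
open Digraph
open Equivalence using (to; from)

-- Deciding competition graphs

-- A closed walk can be rotated to start at its second vertex, so a cycle could be followed down the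
-- accessibility proof forever.
acc⇒no-cycle : ∀ {V : Set} {R : Rel V 0ℓ} {v} → Acc (flip R) v → ¬ TransClosure R v v
acc⇒no-cycle (acc rs) [ vv ]    = acc⇒no-cycle (rs vv) [ vv ]
acc⇒no-cycle (acc rs) (vw ∷ wv) = acc⇒no-cycle (rs vw) (wv ∷ʳ vw)

⁺-mono : ∀ {V : Set} {R S : Rel V 0ℓ} → (∀ {u v} → R u v → S u v) →
         ∀ {u v} → TransClosure R u v → TransClosure S u v
⁺-mono f [ uv ]    = [ f uv ]
⁺-mono f (uv ∷ vw) = f uv ∷ ⁺-mono f vw

_⇔-dec_ : {A B : Set} → Dec A → Dec B → Dec (A ⇔ B)
a? ⇔-dec b? = map′ (uncurry mk⇔) (λ e → to e , from e) ((a? →-dec b?) ×-dec (b? →-dec a?))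

members : ∀ {n} {P : Pred (Fin n) 0ℓ} → Decidable P → Subset n
members P? = tabulate (does ∘ P?)

∈-members : ∀ {n} {P : Pred (Fin n) 0ℓ} (P? : Decidable P) {i} → i ∈ˢ members P? ⇔ P i
∈-members {P = P} P? {i} = mk⇔ sound complete
  where
  sound : i ∈ˢ members P? → P i
  sound i∈ with P? i | trans (sym (lookup∘tabulate (does ∘ P?) i)) ([]=⇒lookup i∈)
  ... | yes p | _ = p
  complete : P i → i ∈ˢ members P?
  complete p = lookup⇒[]= i _ (trans (lookup∘tabulate (does ∘ P?) i) (dec-true (P? i) p))

module _ {V : Set} {N : ℕ} (enumeration : V ↔ Fin N) where

  private
    index = Inverse.to enumeration
    vertex = Inverse.from enumeration

    vertex-index : ∀ v → vertex (index v) ≡ v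
    vertex-index = Inverse.strictlyInverseʳ enumeration

  ∃-dec : {P : Pred V 0ℓ} → Decidable P → Dec (∃ P)
  ∃-dec {P} P? = map′ (λ (i , p) → vertex i , p)
    (λ (v , p) → index v , subst P (sym (vertex-index v)) p) (any? (P? ∘ vertex))

  ∀-dec : {P : Pred V 0ℓ} → Decidable P → Dec (∀ v → P v)
  ∀-dec P? = map′ (λ ¬∃¬P v → decidable-stable (P? v) (λ ¬Pv → ¬∃¬P (v , ¬Pv)))
    (λ ∀P (v , ¬Pv) → ¬Pv (∀P v)) (¬? (∃-dec (¬? ∘ P?)))

  -- Closed walks have unbounded length, whereas there are finitely many vertex sets. This makes
  -- traps the form of cycles that can be searched for.
  Trap : Digraph V → Subset N → Set
  Trap D S = Nonempty S × (∀ v → index v ∈ˢ S → ∃[ w ] (Arc D v w × index w ∈ˢ S))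

  trap? : ∀ D → Decidable (Trap D)
  trap? D S = nonempty? S ×-dec
    ∀-dec (λ v → (index v ∈ˢ? S) →-dec ∃-dec (λ w → arc? D v w ×-dec (index w ∈ˢ? S)))

  -- In an acyclic digraph reachability is a strict partial order on a finite set, hence well
  -- founded, while a walk that stays in a trap would descend forever.
  acyclic⇒no-trap : ∀ {D} → Acyclic D → ∀ {S} → ¬ Trap D S
  acyclic⇒no-trap {D} acyclic {S} ((i , i∈S) , next) = escape (spo-wellFounded isSPO i) i∈S
    where
    _⊏_ : Rel (Fin N) 0ℓ
    i ⊏ j = TransClosure (Arc D) (vertex j) (vertex i)

    isSPO : IsStrictPartialOrder _≡_ _⊏_
    isSPO = record
      { isEquivalence = isEquivalence
      ; irrefl = λ { refl → acyclic _ }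
      ; trans = λ ij jk → jk ++ ij
      ; <-resp-≈ = subst (_ ⊏_) , subst (_⊏ _)
      }

    escape : ∀ {i} → Acc _⊏_ i → ¬ i ∈ˢ S
    escape {i} (acc rs) i∈S
      with w , vw , w∈S ← next (vertex i) (subst (_∈ˢ S) (sym (Inverse.strictlyInverseˡ enumeration i)) i∈S)
      = escape (rs [ subst (Arc D (vertex i)) (sym (vertex-index w)) vw ]) w∈S

  visited : ∀ {R : Rel V 0ℓ} {v w} → TransClosure R v w → Subset N
  visited {v = v} [ _ ]   = ⁅ index v ⁆
  visited {v = v} (_ ∷ p) = ⁅ index v ⁆ ∪ visited p

  start∈visited : ∀ {R : Rel V 0ℓ} {v w} (p : TransClosure R v w) → index v ∈ˢ visited p
  start∈visited [ _ ]   = x∈⁅x⁆ _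
  start∈visited (_ ∷ p) = x∈p∪q⁺ (inj₁ (x∈⁅x⁆ _))

  index-injective : ∀ {u v} → index u ≡ index v → u ≡ v
  index-injective eq = trans (sym (vertex-index _)) (trans (cong vertex eq) (vertex-index _))

  -- `visited` records the start of every arc of the walk, so only the last arc may lead out of the
  -- set, and it leads to `w`. On a closed walk `w` is the start, and the exception disappears.
  visited-next : ∀ {R : Rel V 0ℓ} {v w} (p : TransClosure R v w) →
                 ∀ u → index u ∈ˢ visited p → ∃[ x ] (R u x × (x ≡ w ⊎ index x ∈ˢ visited p))
  visited-next [ vw ] u u∈ with refl ← index-injective (x∈⁅y⁆⇒x≡y _ u∈) = _ , vw , inj₁ refl
  visited-next (vx ∷ p) u u∈ with x∈p∪q⁻ _ (visited p) u∈
  ... | inj₁ u∈v with refl ← index-injective (x∈⁅y⁆⇒x≡y _ u∈v) =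
    _ , vx , inj₂ (x∈p∪q⁺ (inj₂ (start∈visited p)))
  ... | inj₂ u∈p with visited-next p u u∈p
  ...   | x , ux , inj₁ x≡w = x , ux , inj₁ x≡w
  ...   | x , ux , inj₂ x∈p = x , ux , inj₂ (x∈p∪q⁺ (inj₂ x∈p))

  cycle⇒trap : ∀ {D v} → (p : TransClosure (Arc D) v v) → Trap D (visited p)
  cycle⇒trap {D} p = (_ , start∈visited p) , next
    where
    next : ∀ u → index u ∈ˢ visited p → ∃[ x ] (Arc D u x × index x ∈ˢ visited p)
    next u u∈p with visited-next p u u∈p
    ... | _ , ux , inj₁ refl = _ , ux , start∈visited p
    ... | x , ux , inj₂ x∈p  = x , ux , x∈p

  acyclic? : Decidable Acyclic
  acyclic? D = map′ (λ no-trap v p → no-trap (visited p , cycle⇒trap {D} p))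
    (λ acyclic (_ , trap) → acyclic⇒no-trap {D} acyclic trap)
    (¬? (anySubset? (trap? D)))

  -- `Arc` is an arbitrary relation in `Set`, so digraphs themselves cannot be enumerated. Up to
  -- equivalence of arcs each one comes from a set of pairs, and these can.
  decode : Subset (N * N) → Digraph V
  decode s = record
    { Arc  = λ u v → combine (index u) (index v) ∈ˢ s
    ; arc? = λ u v → combine (index u) (index v) ∈ˢ? s
    }

  ArcAt : Digraph V → Fin N × Fin N → Set
  ArcAt D (i , j) = Arc D (vertex i) (vertex j)

  arcAt? : (D : Digraph V) → Decidable (ArcAt D ∘ remQuot {N} N)
  arcAt? D k = arc? D (vertex (proj₁ (remQuot {N} N k))) (vertex (proj₂ (remQuot {N} N k)))

  encode : Digraph V → Subset (N * N)
  encode D = members (arcAt? D)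

  decode-encode : ∀ D {u v} → Arc (decode (encode D)) u v ⇔ Arc D u v
  decode-encode D {u} {v} = mk⇔
    (subst id arcs ∘ to (∈-members (arcAt? D)))
    (from (∈-members (arcAt? D)) ∘ subst id (sym arcs))
    where
    arcs : ArcAt D (remQuot {N} N (combine (index u) (index v))) ≡ Arc D u v
    arcs = trans (cong (ArcAt D) (remQuot-combine (index u) (index v)))
                 (cong₂ (Arc D) (vertex-index u) (vertex-index v))

  isAcyclicCompetitionGraph? : {G : Graph V} → B.Decidable (Adj G) → Dec (IsAcyclicCompetitionGraph G)
  isAcyclicCompetitionGraph? {G} adj? = map′ (λ (s , p) → decode s , p) code
    (anySubset? (λ s → acyclic? (decode s) ×-dec ∀-dec (λ u → ∀-dec (λ v → adj? u v ⇔-dec competes? s u v))))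
    where
    competes? : ∀ s → B.Decidable (Adj (competitionGraph (decode s)))
    competes? s u v =
      map′ (_∘ cong index) (_∘ index-injective) (¬? (index u ≟ index v))
      ×-dec ∃-dec (λ x → arc? (decode s) u x ×-dec arc? (decode s) v x)

    code : IsAcyclicCompetitionGraph G →
           ∃ λ s → Acyclic (decode s) × G ≈ competitionGraph (decode s)
    code (D , acyclic , G≈D) = encode D , (λ v → acyclic v ∘ ⁺-mono (to (decode-encode D))) , λ u v → mk⇔
      (λ uv → let (u≢v , x , ux , vx) = to (G≈D u v) uv
              in u≢v , x , from (decode-encode D) ux , from (decode-encode D) vx)
      (λ (u≢v , x , ux , vx) → from (G≈D u v) (u≢v , x , to (decode-encode D) ux , to (decode-encode D) vx))

-- Existence of the competition number below a known bound.

competitionNumber-≤ : (G : FiniteGraph) → ∀ {m} →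
  IsAcyclicCompetitionGraph (withIsolated (FiniteGraph.graph G) m) →
  ∃[ k ] (IsCompetitionNumber G k × k ≤ m)
competitionNumber-≤ G {m} holds = least m holds
  where
  open FiniteGraph G

  P : ℕ → Set₁
  P j = IsAcyclicCompetitionGraph (withIsolated graph j)

  isolated-adj? : ∀ j → B.Decidable (Adj (withIsolated graph j))
  isolated-adj? j (inj₁ u) (inj₁ v) = map′ old (λ { (old uv) → uv }) (adj? u v)
  isolated-adj? j (inj₁ u) (inj₂ _) = no λ ()
  isolated-adj? j (inj₂ _) _        = no λ ()

  P? : ∀ j → Dec (P j)
  P? j = isAcyclicCompetitionGraph? (↔-sym (+↔⊎ {order} {j})) {withIsolated graph j} (isolated-adj? j)

  search : ∀ m → (∃[ k ] ((P k × (∀ j → P j → k ≤ j)) × k ≤ m)) ⊎ (∀ j → P j → m < j)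
  search zero with P? zero
  ... | yes p = inj₁ (0 , (p , λ _ _ → z≤n) , z≤n)
  ... | no ¬p = inj₂ λ { zero p → contradiction p ¬p ; (suc _) _ → z<s }
  search (suc m) with search m
  ... | inj₁ (k , k-least , k≤m) = inj₁ (k , k-least , ℕ.m≤n⇒m≤1+n k≤m)
  ... | inj₂ above with P? (suc m)
  -- `m < j` unfolds to `suc m ≤ j`, so the failure of the search up to `m` is already the
  -- minimality of `suc m`.
  ...   | yes p = inj₁ (suc m , (p , above) , ≤-refl)
  ...   | no ¬p = inj₂ λ j p → ℕ.≤∧≢⇒< (above j p) λ { refl → ¬p p }

  least : ∀ m → P m → ∃[ k ] (IsCompetitionNumber G k × k ≤ m)
  least m p with search m
  ... | inj₁ found = found
  ... | inj₂ above = contradiction (above m p) (ℕ.n≮n m)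

-- Realizations with two extra vertices

-- An acyclic digraph on `V ⊎ Fin 2` in which the two extra vertices are sinks, so that only arcs
-- inside `V` can form cycles. Well-foundedness replaces acyclicity because it passes easily through
-- pullbacks and gluing.
record Realization {V : Set} (G : Graph V) : Set₁ where
  field
    Prey     : V → V ⊎ Fin 2 → Set
    prey?    : ∀ u x → Dec (Prey u x)
    wf       : WellFounded (λ v u → Prey u (inj₁ v))
    complete : ∀ {u v} → Adj G u v → ∃[ x ] (Prey u x × Prey v x)
    sound    : ∀ {u v x} → u ≢ v → Prey u x → Prey v x → Adj G u v

open Realization

realization⇒competition : ∀ {V} {G : Graph V} → Realization G → IsAcyclicCompetitionGraph (withIsolated G 2)
realization⇒competition {V} {G} R = D , (λ v → acc⇒no-cycle (D-wf v)) , λ u v → mk⇔ forth (back u v)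
  where
  D : Digraph (V ⊎ Fin 2)
  D = record
    { Arc  = λ { (inj₁ u) x → Prey R u x ; (inj₂ _) x → ⊥ }
    ; arc? = λ { (inj₁ u) x → prey? R u x ; (inj₂ _) x → no id }
    }

  old-acc : ∀ {v} → Acc (λ v u → Prey R u (inj₁ v)) v → Acc (flip (Arc D)) (inj₁ v)
  old-acc (acc rs) = acc λ { {inj₁ x} vx → old-acc (rs vx) ; {inj₂ k} _ → acc λ () }

  D-wf : WellFounded (flip (Arc D))
  D-wf (inj₁ v) = old-acc (wf R v)
  D-wf (inj₂ k) = acc λ ()

  forth : ∀ {u v} → WithIsolatedAdj G 2 u v → Adj (competitionGraph D) u v
  forth (old uv) = (λ { refl → irrefl G refl uv }) , complete R uv

  back : ∀ u v → Adj (competitionGraph D) u v → WithIsolatedAdj G 2 u v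
  back (inj₁ u) (inj₁ v) (u≢v , x , ux , vx) = old (sound R (u≢v ∘ cong inj₁) ux vx)
  back (inj₂ _) _        (_ , _ , () , _)
  back (inj₁ _) (inj₂ _) (_ , _ , _ , ())

transport : ∀ {V W} {G : Graph V} {H : Graph W} → G ≅ H → Realization H → Realization G
transport {G = G} {H} G≅H R = record
  { Prey     = λ u x → Prey R (fwd u) (Sum.map₁ fwd x)
  ; prey?    = λ u x → prey? R (fwd u) (Sum.map₁ fwd x)
  ; wf       = On.wellFounded fwd (wf R)
  ; complete = λ {u} {v} uv → pull (complete R (to (preserves u v) uv))
  ; sound    = λ {u} {v} u≢v ux vx →
      from (preserves u v) (sound R (u≢v ∘ Injection.injective (↔⇒↣ bijection)) ux vx)
  }
  where
  open _≅_ G≅H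
  fwd = Inverse.to bijection

  pull : ∀ {u v} → ∃[ y ] (Prey R u y × Prey R v y) →
         ∃[ x ] (Prey R u (Sum.map₁ fwd x) × Prey R v (Sum.map₁ fwd x))
  pull {u} {v} (inj₁ y , uy , vy) = inj₁ (Inverse.from bijection y) ,
    subst (Prey R u ∘ inj₁) (sym (Inverse.strictlyInverseˡ bijection y)) uy ,
    subst (Prey R v ∘ inj₁) (sym (Inverse.strictlyInverseˡ bijection y)) vy
  pull (inj₂ k , uk , vk) = inj₂ k , uk , vk

module _ {V W : Set} (G : Graph V) (K : Pred V 0ℓ) (Q : Graph W) where

  data JoinAdj : Rel (V ⊎ W) 0ℓ where
    left   : ∀ {u v} → Adj G u v → JoinAdj (inj₁ u) (inj₁ v)
    right  : ∀ {p q} → Adj Q p q → JoinAdj (inj₂ p) (inj₂ q)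
    cross  : ∀ {q u} → K u → JoinAdj (inj₂ q) (inj₁ u)
    cross⁻¹ : ∀ {q u} → K u → JoinAdj (inj₁ u) (inj₂ q)

  joinOver : Graph (V ⊎ W)
  joinOver = record
    { Adj    = JoinAdj
    ; symm   = λ { (left uv) → left (symm G uv) ; (right pq) → right (symm Q pq)
                 ; (cross u) → cross⁻¹ u ; (cross⁻¹ u) → cross u }
    ; irrefl = λ { refl (left uu) → irrefl G refl uu ; refl (right qq) → irrefl Q refl qq }
    }

IsClique : ∀ {V} → Graph V → Pred V 0ℓ → Set
IsClique G K = ∀ {u v} → K u → K v → u ≢ v → Adj G u v

-- A vertex without predators carries no clique yet, so it is at the disposal of another graph.
record HasTwoSources {V} {G : Graph V} (R : Realization G) : Set where
  field
    source    : Fin 2 → V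
    distinct  : source zero ≢ source (suc zero)
    unpreyed  : ∀ {v} i → ¬ Prey R v (inj₁ (source i))

  source-injective : ∀ {i j} → source i ≡ source j → i ≡ j
  source-injective {zero}     {zero}     _  = refl
  source-injective {zero}     {suc zero} eq = ⊥-elim (distinct eq)
  source-injective {suc zero} {zero}     eq = ⊥-elim (distinct (sym eq))
  source-injective {suc zero} {suc zero} _  = refl

-- The two sources of the realization of Q take over the rôle of the two isolated vertices of G, and K joins
-- every other clique of Q, so that two isolated vertices are again left over.
join-realization : ∀ {V W} {G : Graph V} {K : Pred V 0ℓ} {Q : Graph W} → DecidableEquality W →
  Decidable K → IsClique G K → Realization G →
  (R : Realization Q) → HasTwoSources R → (∀ q → ∃ (Prey R q)) → Realization (joinOver G K Q)
join-realization {V} {W} {G} {K} {Q} _≟W_ K? clique S R two hasPrey = record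
  { Prey = _⟶_ ; prey? = _⟶?_ ; wf = ⟶-wf ; complete = ⟶-complete ; sound = ⟶-sound }
  where
  open HasTwoSources two

  IsSource : W → Set
  IsSource q = ∃[ i ] q ≡ source i

  isSource? : Decidable IsSource
  isSource? q = any? (λ i → q ≟W source i)

  _⟶_ : V ⊎ W → (V ⊎ W) ⊎ Fin 2 → Set
  inj₁ u ⟶ inj₁ (inj₁ v) = Prey S u (inj₁ v)
  inj₁ u ⟶ inj₁ (inj₂ q) = (∃[ i ] (q ≡ source i × Prey S u (inj₂ i))) ⊎ (K u × ¬ IsSource q)
  inj₁ u ⟶ inj₂ k        = K u
  inj₂ q ⟶ inj₁ (inj₁ v) = ⊥
  inj₂ q ⟶ inj₁ (inj₂ r) = Prey R q (inj₁ r)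
  inj₂ q ⟶ inj₂ k        = Prey R q (inj₂ k)

  _⟶?_ : ∀ u x → Dec (u ⟶ x)
  inj₁ u ⟶? inj₁ (inj₁ v) = prey? S u (inj₁ v)
  inj₁ u ⟶? inj₁ (inj₂ q) =
    any? (λ i → (q ≟W source i) ×-dec prey? S u (inj₂ i)) ⊎-dec (K? u ×-dec ¬? (isSource? q))
  inj₁ u ⟶? inj₂ k        = K? u
  inj₂ q ⟶? inj₁ (inj₁ v) = no id
  inj₂ q ⟶? inj₁ (inj₂ r) = prey? R q (inj₁ r)
  inj₂ q ⟶? inj₂ k        = prey? R q (inj₂ k)

  _⟵_ : Rel (V ⊎ W) 0ℓ
  x ⟵ u = u ⟶ inj₁ x

  acc-right : ∀ {q} → Acc (λ r q → Prey R q (inj₁ r)) q → Acc _⟵_ (inj₂ q)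
  acc-right (acc rs) = acc λ { {inj₂ r} qr → acc-right (rs qr) }

  acc-left : ∀ {v} → Acc (λ w v → Prey S v (inj₁ w)) v → Acc _⟵_ (inj₁ v)
  acc-left (acc rs) = acc λ { {inj₁ w} vw → acc-left (rs vw) ; {inj₂ q} _ → acc-right (wf R q) }

  ⟶-wf : WellFounded _⟵_
  ⟶-wf (inj₁ v) = acc-left (wf S v)
  ⟶-wf (inj₂ q) = acc-right (wf R q)

  common : ∀ {u q} → K u → ∃[ x ] (inj₂ q ⟶ x × inj₁ u ⟶ x)
  common {q = q} u∈K with hasPrey q
  -- The vertex `r` has the predator `q`, so it is not a source and `K` joins its clique.
  ... | inj₁ r , qr = inj₁ (inj₂ r) , qr , inj₂ (u∈K , λ { (i , refl) → unpreyed i qr })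
  ... | inj₂ k , qk = inj₂ k , qk , u∈K

  ⟶-complete : ∀ {u v} → JoinAdj G K Q u v → ∃[ x ] (u ⟶ x × v ⟶ x)
  ⟶-complete (left uv) with complete S uv
  ... | inj₁ x , ux , vx = inj₁ (inj₁ x) , ux , vx
  ... | inj₂ i , ui , vi = inj₁ (inj₂ (source i)) , inj₁ (i , refl , ui) , inj₁ (i , refl , vi)
  ⟶-complete (right pq) with complete R pq
  ... | inj₁ r , pr , qr = inj₁ (inj₂ r) , pr , qr
  ... | inj₂ k , pk , qk = inj₂ k , pk , qk
  ⟶-complete (cross u∈K)   = common u∈K
  ⟶-complete (cross⁻¹ u∈K) = let (x , qx , ux) = common u∈K in x , ux , qx

  ⟶-sound : ∀ {u v x} → u ≢ v → u ⟶ x → v ⟶ x → JoinAdj G K Q u v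
  ⟶-sound {inj₁ u} {inj₁ v} {inj₁ (inj₁ x)} u≢v ux vx = left (sound S (u≢v ∘ cong inj₁) ux vx)
  ⟶-sound {inj₁ u} {inj₁ v} {inj₁ (inj₂ q)} u≢v (inj₁ (i , q≡i , ui)) (inj₁ (j , q≡j , vj))
    with refl ← source-injective (trans (sym q≡i) q≡j) = left (sound S (u≢v ∘ cong inj₁) ui vj)
  ⟶-sound {inj₁ u} {inj₁ v} {inj₁ (inj₂ q)} u≢v (inj₁ (i , q≡i , _)) (inj₂ (_ , q∉)) = contradiction (i , q≡i) q∉
  ⟶-sound {inj₁ u} {inj₁ v} {inj₁ (inj₂ q)} u≢v (inj₂ (_ , q∉)) (inj₁ (i , q≡i , _)) = contradiction (i , q≡i) q∉
  ⟶-sound {inj₁ u} {inj₁ v} {inj₁ (inj₂ q)} u≢v (inj₂ (u∈K , _)) (inj₂ (v∈K , _)) =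
    left (clique u∈K v∈K (u≢v ∘ cong inj₁))
  ⟶-sound {inj₁ u} {inj₁ v} {inj₂ k} u≢v u∈K v∈K = left (clique u∈K v∈K (u≢v ∘ cong inj₁))
  ⟶-sound {inj₁ u} {inj₂ q} {inj₁ (inj₂ r)} _ (inj₁ (i , refl , _)) qr = contradiction qr (unpreyed i)
  ⟶-sound {inj₁ u} {inj₂ q} {inj₁ (inj₂ r)} _ (inj₂ (u∈K , _)) qr = cross⁻¹ u∈K
  ⟶-sound {inj₁ u} {inj₂ q} {inj₂ k} _ u∈K _ = cross⁻¹ u∈K
  ⟶-sound {inj₂ q} {inj₁ u} {inj₁ (inj₂ r)} _ qr (inj₁ (i , refl , _)) = contradiction qr (unpreyed i)
  ⟶-sound {inj₂ q} {inj₁ u} {inj₁ (inj₂ r)} _ qr (inj₂ (u∈K , _)) = cross u∈K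
  ⟶-sound {inj₂ q} {inj₁ u} {inj₂ k} _ _ u∈K = cross u∈K
  ⟶-sound {inj₂ p} {inj₂ q} {inj₁ (inj₂ r)} p≢q pr qr = right (sound R (p≢q ∘ cong inj₂) pr qr)
  ⟶-sound {inj₂ p} {inj₂ q} {inj₂ k} p≢q pk qk = right (sound R (p≢q ∘ cong inj₂) pk qk)

-- Cocktail party graphs

_≟CP_ : ∀ {m} → DecidableEquality (CPVertex m)
_≟CP_ = Product.≡-dec _≟_ Bool._≟_

private
  side : Fin 2 → Bool
  side zero       = true
  side (suc zero) = false

  side⁻¹ : ∀ s → ∃[ k ] s ≡ side k
  side⁻¹ true  = zero , refl
  side⁻¹ false = suc zero , refl

-- Two vertices of the cocktail party graph are adjacent iff they are distinct and not antipodal, so it is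
-- enough that antipodal vertices never share a prey.
cocktailParty-sound : ∀ {m} {X : Set} (Prey : CPVertex m → X → Set) →
  (∀ {i x} → Prey (i , true) x → ¬ Prey (i , false) x) →
  ∀ {p q x} → p ≢ q → Prey p x → Prey q x → proj₁ p ≢ proj₁ q
cocktailParty-sound Prey antipodal {_ , true}  {_ , true}  p≢q _  _  refl = p≢q refl
cocktailParty-sound Prey antipodal {_ , true}  {_ , false} _   px qx refl = antipodal px qx
cocktailParty-sound Prey antipodal {_ , false} {_ , true}  _   px qx refl = antipodal qx px
cocktailParty-sound Prey antipodal {_ , false} {_ , false} p≢q _  _  refl = p≢q refl

record SpareRealization {W : Set} (Q : Graph W) : Set₁ where
  field
    realization : Realization Q
    twoSources  : HasTwoSources realization
    hasPrey     : ∀ q → ∃ (Prey realization q)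

-- The two vertices are not adjacent, so each gets an extra vertex of its own as prey. These
-- one-element cliques let a star that is glued on reach both vertices, and both are sources since
-- no arc enters them.
cocktailParty-1 : SpareRealization (cocktailParty 1)
cocktailParty-1 = record
  { realization = record
    { Prey     = Prey₁
    ; prey?    = λ { _ (inj₁ _) → no id ; (_ , s) (inj₂ k) → s Bool.≟ side k }
    ; wf       = λ _ → acc λ ()
    ; complete = λ { {zero , _} {zero , _} p≢q → contradiction refl p≢q }
    ; sound    = λ {p} {q} {x} → cocktailParty-sound Prey₁ (λ {i} {x} → antipodal {i} {x}) {p} {q} {x}
    }
  ; twoSources = record { source = λ k → zero , side k ; distinct = λ () ; unpreyed = λ _ () }
  ; hasPrey = λ (_ , s) → let (k , s≡) = side⁻¹ s in inj₂ k , s≡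
  }
  where
  Prey₁ : CPVertex 1 → CPVertex 1 ⊎ Fin 2 → Set
  Prey₁ _       (inj₁ _) = ⊥
  Prey₁ (_ , s) (inj₂ k) = s ≡ side k

  antipodal : ∀ {i x} → Prey₁ (i , true) x → ¬ Prey₁ (i , false) x
  antipodal {x = inj₂ zero} _ ()
  antipodal {x = inj₂ (suc zero)} ()

-- With a = (zero , true), b = (zero , false), x i = (suc i , true) and y i = (suc i , false), the vertices in
-- decreasing rank are a, y (n-1), x (n-1), …, y 0, x 0, b. The two isolated vertices receive {b, x 0, x 1, …}
-- and {b, y 0, y 1, …}; x i receives {a, y i} ∪ {x j : j > i}, and the vertex of level c receives
-- {a, x c} ∪ {y j : j > c} for c < n, where b has level 0 and y i level i + 1. Nothing is left for a and y (n-1).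
module _ (p : ℕ) where

  private
    n = suc p

    IntoX : CPVertex (suc n) → Fin n → Set
    IntoX (zero  , true)  i = ⊤
    IntoX (zero  , false) i = ⊥
    IntoX (suc j , true)  i = i Fin.< j
    IntoX (suc j , false) i = j ≡ i

    IntoLevel : CPVertex (suc n) → ℕ → Set
    IntoLevel (zero  , true)  c = c < n
    IntoLevel (zero  , false) c = ⊥
    IntoLevel (suc j , true)  c = toℕ j ≡ c
    IntoLevel (suc j , false) c = c < toℕ j

    Arc₂ : CPVertex (suc n) → CPVertex (suc n) ⊎ Fin 2 → Set
    Arc₂ u           (inj₁ (zero  , true))  = ⊥
    Arc₂ u           (inj₁ (zero  , false)) = IntoLevel u 0
    Arc₂ u           (inj₁ (suc i , true))  = IntoX u i
    Arc₂ u           (inj₁ (suc i , false)) = IntoLevel u (suc (toℕ i))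
    Arc₂ (zero  , s) (inj₂ k)               = s ≡ false
    Arc₂ (suc j , s) (inj₂ k)               = s ≡ side k

    intoX? : ∀ u i → Dec (IntoX u i)
    intoX? (zero  , true)  i = yes tt
    intoX? (zero  , false) i = no id
    intoX? (suc j , true)  i = i Fin.<? j
    intoX? (suc j , false) i = j ≟ i

    intoLevel? : ∀ u c → Dec (IntoLevel u c)
    intoLevel? (zero  , true)  c = c <? n
    intoLevel? (zero  , false) c = no id
    intoLevel? (suc j , true)  c = toℕ j ℕ.≟ c
    intoLevel? (suc j , false) c = c <? toℕ j

    arc₂? : ∀ u x → Dec (Arc₂ u x)
    arc₂? u           (inj₁ (zero  , true))  = no id
    arc₂? u           (inj₁ (zero  , false)) = intoLevel? u 0
    arc₂? u           (inj₁ (suc i , true))  = intoX? u i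
    arc₂? u           (inj₁ (suc i , false)) = intoLevel? u (suc (toℕ i))
    arc₂? (zero  , s) (inj₂ k)               = s Bool.≟ false
    arc₂? (suc j , s) (inj₂ k)               = s Bool.≟ side k

    -- The vertex of level `c` has rank `c * 2`, and `x i` has the odd rank between levels `i` and
    -- `i + 1`. The highest level is `n`, that of `y (n-1)`, and `a` lies just above it.
    rank : CPVertex (suc n) → ℕ
    rank (zero  , true)  = suc (n * 2)
    rank (zero  , false) = 0
    rank (suc i , true)  = suc (toℕ i * 2)
    rank (suc i , false) = suc (toℕ i) * 2

    double-< : ∀ {i j} → i < j → i * 2 < j * 2
    double-< = ℕ.*-monoˡ-< 2

    level-decreasing : ∀ u c → IntoLevel u c → c * 2 < rank u
    level-decreasing (zero  , true)  c c<n  = ℕ.m<n⇒m<1+n (double-< c<n)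
    level-decreasing (suc j , true)  _ refl = ≤-refl
    level-decreasing (suc j , false) c c<j  = double-< (ℕ.m<n⇒m<1+n c<j)

    x-decreasing : ∀ u i → IntoX u i → suc (toℕ i * 2) < rank u
    x-decreasing (zero  , true)  i _    = s≤s (double-< (toℕ<n i))
    x-decreasing (suc j , true)  i i<j  = s≤s (double-< i<j)
    x-decreasing (suc j , false) _ refl = ≤-refl

    decreasing : ∀ {u v} → Arc₂ u (inj₁ v) → rank v < rank u
    decreasing {u} {zero  , false} = level-decreasing u 0
    decreasing {u} {suc i , true}  = x-decreasing u i
    decreasing {u} {suc i , false} = level-decreasing u (suc (toℕ i))

    atLevel : ∀ i → i < n → ∃[ x ] (∀ u → IntoLevel u i → Arc₂ u x)
    atLevel zero    _     = inj₁ (zero , false) , λ _ → id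
    atLevel (suc i) 1+i<n = inj₁ (suc (Fin.fromℕ< i<n) , false) ,
      λ u → subst (IntoLevel u ∘ suc) (sym (Fin.toℕ-fromℕ< i<n))
      where i<n = ℕ.<-trans (ℕ.n<1+n i) 1+i<n

    Common : CPVertex (suc n) → CPVertex (suc n) → Set
    Common u v = ∃[ x ] (Arc₂ u x × Arc₂ v x)

    commonAtLevel : ∀ {u v} c → c < n → IntoLevel u c → IntoLevel v c → Common u v
    commonAtLevel {u} {v} c c<n uc vc = let (x , arc) = atLevel c c<n in x , arc u uc , arc v vc

    flipped : ∀ {u v} → Common u v → Common v u
    flipped (x , ux , vx) = x , vx , ux

    -- The prey depends on the order: the vertex of level `i` if `i < j`, and `x j` if `j < i`.
    mixed : ∀ i j → i ≢ j → Common (suc i , true) (suc j , false)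
    mixed i j i≢j with Fin.<-cmp i j
    ... | tri< i<j _ _ = commonAtLevel {suc i , true} {suc j , false} (toℕ i) (toℕ<n i) refl i<j
    ... | tri≈ _ i≡j _ = contradiction i≡j i≢j
    ... | tri> _ _ j<i = inj₁ (suc j , true) , j<i , refl

    top : ∀ j s → Common (zero , true) (suc j , s)
    top j true  = commonAtLevel {zero , true} {suc j , true} (toℕ j) (toℕ<n j) (toℕ<n j) refl
    top j false = inj₁ (suc j , true) , tt , refl

    bottom : ∀ j s → Common (zero , false) (suc j , s)
    bottom j s = let (k , s≡) = side⁻¹ s in inj₂ k , refl , s≡

    complete₂ : ∀ {u v} → proj₁ u ≢ proj₁ v → Common u v
    complete₂ {zero  , _}     {zero  , _}     u≢v = contradiction refl u≢v
    complete₂ {zero  , true}  {suc j , s}     _   = top j s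
    complete₂ {zero  , false} {suc j , s}     _   = bottom j s
    complete₂ {suc i , s}     {zero  , true}  _   = flipped (top i s)
    complete₂ {suc i , s}     {zero  , false} _   = flipped (bottom i s)
    complete₂ {suc i , true}  {suc j , true}  _   = inj₂ zero , refl , refl
    complete₂ {suc i , false} {suc j , false} _   = inj₂ (suc zero) , refl , refl
    complete₂ {suc i , true}  {suc j , false} i≢j = mixed i j (i≢j ∘ cong suc)
    complete₂ {suc i , false} {suc j , true}  i≢j = flipped (mixed j i (i≢j ∘ cong suc ∘ sym))

    antipodal-level : ∀ i c → IntoLevel (i , true) c → ¬ IntoLevel (i , false) c
    antipodal-level zero    c _    ()
    antipodal-level (suc i) _ refl = ℕ.n≮n _

    antipodal : ∀ {i x} → Arc₂ (i , true) x → ¬ Arc₂ (i , false) x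
    antipodal {i}     {inj₁ (zero  , false)} = antipodal-level i 0
    antipodal {i}     {inj₁ (suc j , false)} = antipodal-level i (suc (toℕ j))
    antipodal {zero}  {inj₁ (suc j , true)}  _ ()
    antipodal {suc i} {inj₁ (suc j , true)}  j<i refl = ℕ.n≮n _ j<i
    antipodal {zero}  {inj₂ _}               ()
    antipodal {suc i} {inj₂ zero}            _ ()
    antipodal {suc i} {inj₂ (suc zero)}      ()

    -- The vertex `y (n-1)` has level `n`, while each clause of `IntoLevel` reaches only levels
    -- below `n`.
    unpreyed-top : ∀ u → ¬ IntoLevel u (suc (toℕ (fromℕ p)))
    unpreyed-top u uc rewrite toℕ-fromℕ p with u
    ... | zero  , true  = ℕ.n≮n _ uc
    ... | suc j , true  = ℕ.<⇒≢ (toℕ<n j) uc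
    ... | suc j , false = ℕ.<-asym uc (toℕ<n j)

  cocktailParty-2+ : SpareRealization (cocktailParty (suc n))
  cocktailParty-2+ = record
    { realization = record
      { Prey     = Arc₂
      ; prey?    = arc₂?
      ; wf       = Subrelation.wellFounded (λ {v} {u} → decreasing {u} {v}) (On.wellFounded rank <-wellFounded)
      ; complete = λ {u} {v} → complete₂ {u} {v}
      ; sound    = λ {u} {v} {x} → cocktailParty-sound Arc₂ (λ {i} {x} → antipodal {i} {x}) {u} {v} {x}
      }
    ; twoSources = record
      { source   = λ { zero → zero , true ; (suc zero) → suc (fromℕ p) , false }
      ; distinct = λ ()
      ; unpreyed = λ { {u} zero → id ; {u} (suc zero) → unpreyed-top u }
      }
    ; hasPrey = λ
      -- The vertex `b` has level 0, and `0 < n` since `n` is `suc p`.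
      { (zero  , true)  → inj₁ (zero , false) , z<s
      ; (zero  , false) → inj₂ zero , refl
      ; (suc j , s)     → let (k , s≡) = side⁻¹ s in inj₂ k , s≡
      }
    }

-- Gluing on a family of cocktail party graphs.

trim-empty : ∀ {V W} {G : Graph V} {H : Graph (V ⊎ W)} → ¬ W →
             (∀ {u v} → Adj H (inj₁ u) (inj₁ v) ⇔ Adj G u v) → H ≅ G
trim-empty {V} {W} ¬W G⇔H = record
  { bijection = mk↔ₛ′ trim inj₁ (λ _ → refl) λ { (inj₁ _) → refl ; (inj₂ w) → contradiction w ¬W }
  ; preserves = λ { (inj₁ u) (inj₁ v) → G⇔H
                  ; (inj₁ _) (inj₂ w) → contradiction w ¬W
                  ; (inj₂ w) _        → contradiction w ¬W }
  }
  where
  trim : V ⊎ W → V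
  trim (inj₁ v) = v
  trim (inj₂ w) = contradiction w ¬W

join-cocktailParty : ∀ {V} {G : Graph V} {K : Pred V 0ℓ} → Decidable K → IsClique G K → Realization G →
                     ∀ m → Realization (joinOver G K (cocktailParty m))
-- `CP(0)` adds no vertex, but the vertex type is still a sum, whose empty summand has to be
-- removed.
join-cocktailParty K? clique S zero = transport (trim-empty (λ ()) (mk⇔ (λ { (left uv) → uv }) left)) S
join-cocktailParty K? clique S (suc m) = join-realization _≟CP_ K? clique S realization twoSources hasPrey
  where
  spare : ∀ m → SpareRealization (cocktailParty (suc m))
  spare zero    = cocktailParty-1
  spare (suc p) = cocktailParty-2+ p
  open SpareRealization (spare m)

module _ {V : Set} (G : Graph V) {k : ℕ} (K : Fin k → Pred V 0ℓ) (f : Fin k → ℕ) where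

  data AttachAdj : Rel (V ⊎ Σ (Fin k) (CPVertex ∘ f)) 0ℓ where
    base    : ∀ {u v} → Adj G u v → AttachAdj (inj₁ u) (inj₁ v)
    party   : ∀ {i p q} → Adj (cocktailParty (f i)) p q → AttachAdj (inj₂ (i , p)) (inj₂ (i , q))
    cross   : ∀ {i q u} → K i u → AttachAdj (inj₂ (i , q)) (inj₁ u)
    cross⁻¹ : ∀ {i q u} → K i u → AttachAdj (inj₁ u) (inj₂ (i , q))

  -- Generalized line graphs with any base graph and any vertex sets in place of the stars. An
  -- induction on the number of sets needs this form, since a line graph with one party glued on may
  -- fail to be a line graph.
  attach : Graph (V ⊎ Σ (Fin k) (CPVertex ∘ f))
  attach = record
    { Adj    = AttachAdj
    ; symm   = λ { (base uv) → base (symm G uv)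
                 ; (party {i} {p} {q} pq) → party {i} {q} {p} (symm (cocktailParty (f i)) {p} {q} pq)
                 ; (cross u) → cross⁻¹ u ; (cross⁻¹ u) → cross u }
    ; irrefl = λ { refl (base uu) → irrefl G refl uu
                 ; refl (party {i} {p} pp) → irrefl (cocktailParty (f i)) {p} refl pp }
    }

-- The first party is absorbed into the base. The later sets contain none of its vertices, as
-- distinct parties are not joined.
attach-suc : ∀ {V} (G : Graph V) {k} (K : Fin (suc k) → Pred V 0ℓ) f →
  attach G K f ≅ attach (joinOver G (K zero) (cocktailParty (f zero)))
                        (λ i → Sum.[ K (suc i) , (λ _ → ⊥) ]) (f ∘ suc)
attach-suc {V} G {k} K f = record
  { bijection = mk↔ₛ′ fwd bwd
      (λ { (inj₁ (inj₁ _)) → refl ; (inj₁ (inj₂ _)) → refl ; (inj₂ _) → refl })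
      (λ { (inj₁ _) → refl ; (inj₂ (zero , _)) → refl ; (inj₂ (suc _ , _)) → refl })
  ; preserves = λ u v → mk⇔ forth (back u v)
  }
  where
  A = attach G K f
  B = attach (joinOver G (K zero) (cocktailParty (f zero))) (λ i → Sum.[ K (suc i) , (λ _ → ⊥) ]) (f ∘ suc)

  fwd : V ⊎ Σ (Fin (suc k)) (CPVertex ∘ f) → (V ⊎ CPVertex (f zero)) ⊎ Σ (Fin k) (CPVertex ∘ f ∘ suc)
  fwd (inj₁ v)           = inj₁ (inj₁ v)
  fwd (inj₂ (zero , q))  = inj₁ (inj₂ q)
  fwd (inj₂ (suc i , q)) = inj₂ (i , q)

  bwd : (V ⊎ CPVertex (f zero)) ⊎ Σ (Fin k) (CPVertex ∘ f ∘ suc) → V ⊎ Σ (Fin (suc k)) (CPVertex ∘ f)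
  bwd (inj₁ (inj₁ v)) = inj₁ v
  bwd (inj₁ (inj₂ q)) = inj₂ (zero , q)
  bwd (inj₂ (i , q))  = inj₂ (suc i , q)

  forth : ∀ {u v} → Adj A u v → Adj B (fwd u) (fwd v)
  forth (base uv)           = base (left uv)
  forth (party {zero} {p} {q} pq) = base (right {p = p} {q} pq)
  forth (party {suc i} {p} {q} pq) = party {p = p} {q} pq
  forth (cross {zero} u)    = base (cross u)
  forth (cross {suc i} u)   = cross u
  forth (cross⁻¹ {zero} u)  = base (cross⁻¹ u)
  forth (cross⁻¹ {suc i} u) = cross⁻¹ u

  back : ∀ u v → Adj B (fwd u) (fwd v) → Adj A u v
  back (inj₁ _)           (inj₁ _)           (base (left uv))   = base uv
  back (inj₁ _)           (inj₂ (zero , _))  (base (cross⁻¹ u)) = cross⁻¹ u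
  back (inj₁ _)           (inj₂ (suc _ , _)) (cross⁻¹ u)        = cross⁻¹ u
  back (inj₂ (zero , _))  (inj₁ _)           (base (cross u))   = cross u
  back (inj₂ (zero , p))  (inj₂ (zero , q))  (base (right pq))  = party {p = p} {q} pq
  back (inj₂ (zero , _))  (inj₂ (suc _ , _)) (cross⁻¹ ())
  back (inj₂ (suc _ , _)) (inj₁ _)           (cross u)          = cross u
  back (inj₂ (suc _ , _)) (inj₂ (zero , _))  (cross ())
  back (inj₂ (suc _ , p)) (inj₂ (suc _ , q)) (party pq)         = party {p = p} {q} pq

attach-realization : ∀ {V} {G : Graph V} {k} {K : Fin k → Pred V 0ℓ} f →
  (∀ i → Decidable (K i)) → (∀ i → IsClique G (K i)) → Realization G → Realization (attach G K f)
attach-realization {k = zero} f K? clique S =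
  transport (trim-empty (λ ()) (mk⇔ (λ { (base uv) → uv }) base)) S
attach-realization {V} {G} {suc k} {K} f K? clique S =
  transport (attach-suc G K f) (attach-realization (f ∘ suc)
    (λ { i (inj₁ v) → K? (suc i) v ; i (inj₂ _) → no id })
    (λ { i {inj₁ u} {inj₁ v} u∈K v∈K u≢v → left (clique (suc i) u∈K v∈K (u≢v ∘ cong inj₁)) })
    (join-cocktailParty (K? zero) (clique zero) S (f zero)))

-- Line graphs

module _ {n : ℕ} {H : Graph (Fin n)} where

  _≟ₑ_ : DecidableEquality (Edge H)
  edge l h _ _ ≟ₑ edge l′ h′ _ _ with l ≟ l′ | h ≟ h′
  ... | yes refl | yes refl = yes refl
  ... | no l≢l′  | _        = no λ { refl → l≢l′ refl }
  ... | yes _    | no h≢h′  = no λ { refl → h≢h′ refl }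

  _∈ₑ?_ : ∀ v (e : Edge H) → Dec (v ∈ₑ e)
  v ∈ₑ? e = (v ≟ Edge.lo e) ⊎-dec (v ≟ Edge.hi e)

  otherEnd : ∀ {v} (e : Edge H) → v ∈ₑ e → ∃[ w ] (w ∈ₑ e × (∀ {u} → u ∈ₑ e → u ≡ v ⊎ u ≡ w))
  otherEnd (edge l h _ _) (inj₁ refl) = h , inj₂ refl , id
  otherEnd (edge l h _ _) (inj₂ refl) = l , inj₁ refl , Sum.swap

  edgesBetween : B.Decidable (Adj H) → Fin n × Fin n → List (Edge H)
  edgesBetween adj? (l , h) with l Fin.<? h | adj? l h
  ... | yes l<h | yes lh = edge l h l<h lh ∷ []
  ... | _       | _      = []

  ∈-edgesBetween : ∀ adj? (e : Edge H) → e ∈ edgesBetween adj? (Edge.lo e , Edge.hi e)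
  ∈-edgesBetween adj? (edge l h l<h lh) with l Fin.<? h | adj? l h
  ... | yes _   | yes _  = here refl
  ... | no  l≮h | _      = ⊥-elim-irr (l≮h l<h)
  ... | yes _   | no ¬lh = ⊥-elim-irr (¬lh lh)

  allEdges : B.Decidable (Adj H) → List (Edge H)
  allEdges adj? = concatMap (edgesBetween adj?) (cartesianProduct (allFin n) (allFin n))

  ∈-allEdges : (adj? : B.Decidable (Adj H)) → ∀ e → e ∈ allEdges adj?
  ∈-allEdges adj? e = ∈-concatMap⁺ (edgesBetween adj?)
    (lose (∈-cartesianProduct⁺ (∈-allFin _) (∈-allFin _)) (∈-edgesBetween adj? e))

-- The edges of H are put one after the other in front of the order, extending a component of the edge set
-- while possible. Every vertex v met so far has reserved a prey 'slot v' for the clique of its edges, with one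
-- exception: a vertex met by a single edge needs no prey yet, and never does if its component is exhausted.
-- So two vertices of the digraph always remain free, both when an edge meets the current component (it brings
-- one free vertex and at most one new vertex of H) and when a new component starts.
module LineGraph {n : ℕ} {H : Graph (Fin n)} (adj? : B.Decidable (Adj H)) where

  private
    E = Edge H
    X = E ⊎ Fin 2

  _─_ : List E → E → List E
  todo ─ e = filter (λ d → ¬? (d ≟ₑ e)) todo

  PlacedX : List E → X → Set
  PlacedX todo (inj₁ e) = e ∉ todo
  PlacedX todo (inj₂ _) = ⊤

  placed-─ : ∀ {todo e d} → d ∉ todo ─ e → d ≡ e ⊎ d ∉ todo
  placed-─ {todo} {e} {d} d∉ with d ≟ₑ e
  ... | yes d≡e = inj₁ d≡e
  ... | no  d≢e = inj₂ λ d∈ → d∉ (∈-filter⁺ (λ d → ¬? (d ≟ₑ e)) d∈ d≢e)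

  ─-⊆ : ∀ {todo e d} → d ∈ todo ─ e → d ∈ todo
  ─-⊆ {e = e} = proj₁ ∘ ∈-filter⁻ (λ d → ¬? (d ≟ₑ e))

  ∉-─ : ∀ {todo e} → e ∉ todo ─ e
  ∉-─ {todo} {e} e∈ = proj₂ (∈-filter⁻ (λ d → ¬? (d ≟ₑ e)) {xs = todo} e∈) refl

  placedX-─ : ∀ {todo e} x → PlacedX todo x → PlacedX (todo ─ e) x
  placedX-─ (inj₁ d) d∉ = d∉ ∘ ─-⊆
  placedX-─ (inj₂ _) _  = tt

  -- The shift by one lets `height rank x ≤ rank e` express both that an edge `x` has smaller rank
  -- than `e` and that an extra vertex precedes every edge.
  height : (E → ℕ) → X → ℕ
  height rank (inj₁ e) = suc (rank e)
  height rank (inj₂ _) = 0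

  -- `rank` records the time of placement, and `clock` is the rank of the next edge. By `slot-older`
  -- each edge preys on something older, which gives acyclicity; by `slot-inj` a prey determines its
  -- star.
  record Reservation (todo : List E) : Set where
    field
      rank        : E → ℕ
      clock       : ℕ
      slot        : Fin n → Maybe X
      bounded     : ∀ {x} → PlacedX todo x → height rank x ≤ clock
      slot-placed : ∀ {v x} → slot v ≡ just x → PlacedX todo x
      slot-inj    : ∀ {v w x} → slot v ≡ just x → slot w ≡ just x → v ≡ w
      slot-older  : ∀ {v x e} → slot v ≡ just x → e ∉ todo → v ∈ₑ e → height rank x ≤ rank e

    Owned : Fin n → Set
    Owned v = ∃[ x ] slot v ≡ just x

    Free : X → Set
    Free x = PlacedX todo x × (∀ v → slot v ≢ just x)

    OlderThanStar : X → Fin n → Set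
    OlderThanStar x v = ∀ {e} → e ∉ todo → v ∈ₑ e → height rank x ≤ rank e

    -- The alternative `d ≡ e` excuses a vertex met by a single placed edge: its star has no two
    -- members to make adjacent.
    Covered : Set
    Covered = ∀ {v d e} → d ∉ todo → e ∉ todo → v ∈ₑ d → v ∈ₑ e → d ≡ e ⊎ Owned v

    owned? : ∀ v → Dec (Owned v)
    owned? v with slot v
    ... | just x  = yes (x , refl)
    ... | nothing = no λ ()

  open Reservation

  module Assign {todo} (R : Reservation todo) (v : Fin n) (z : X) (free : Free R z) (older : OlderThanStar R z v) where

    slot′ : Fin n → Maybe X
    slot′ w with w ≟ v
    ... | yes _ = just z
    ... | no  _ = slot R w

    slot′-cases : ∀ w {x} → slot′ w ≡ just x → (w ≡ v × x ≡ z) ⊎ slot R w ≡ just x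
    slot′-cases w eq with w ≟ v
    slot′-cases w refl | yes w≡v = inj₁ (w≡v , refl)
    slot′-cases w eq   | no _    = inj₂ eq

    assigned : Reservation todo
    assigned = record
      { rank = rank R ; clock = clock R ; slot = slot′ ; bounded = bounded R
      ; slot-placed = λ {w} eq → placed′ (slot′-cases w eq)
      ; slot-inj = λ {u} {w} eq eq′ → inj′ (slot′-cases u eq) (slot′-cases w eq′)
      ; slot-older = λ {w} eq → older′ (slot′-cases w eq)
      }
      where
      placed′ : ∀ {w x} → (w ≡ v × x ≡ z) ⊎ slot R w ≡ just x → PlacedX todo x
      placed′ (inj₁ (_ , refl)) = proj₁ free
      placed′ (inj₂ eq)         = slot-placed R eq

      inj′ : ∀ {u w x} → (u ≡ v × x ≡ z) ⊎ slot R u ≡ just x → (w ≡ v × x ≡ z) ⊎ slot R w ≡ just x → u ≡ w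
      inj′ (inj₁ (u≡v , _))  (inj₁ (w≡v , _))  = trans u≡v (sym w≡v)
      inj′ (inj₁ (_ , refl)) (inj₂ eq)         = contradiction eq (proj₂ free _)
      inj′ (inj₂ eq)         (inj₁ (_ , refl)) = contradiction eq (proj₂ free _)
      inj′ (inj₂ eq)         (inj₂ eq′)        = slot-inj R eq eq′

      older′ : ∀ {w x e} → (w ≡ v × x ≡ z) ⊎ slot R w ≡ just x → e ∉ todo → w ∈ₑ e → height (rank R) x ≤ rank R e
      older′ (inj₁ (refl , refl)) = older
      older′ (inj₂ eq)            = slot-older R eq

    owned-new : Owned assigned v
    owned-new with v ≟ v
    ... | yes _  = z , refl
    ... | no v≢v = contradiction refl v≢v

    owned-old : ∀ {w} → Owned R w → Owned assigned w
    owned-old {w} owned with w ≟ v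
    ... | yes _ = z , refl
    ... | no _  = owned

    free-old : ∀ {x} → x ≢ z → Free R x → Free assigned x
    free-old x≢z (placed , unused) = placed , λ w eq → keep (slot′-cases w eq)
      where
      keep : ∀ {w} → ¬ ((w ≡ v × _ ≡ z) ⊎ slot R w ≡ just _)
      keep (inj₁ (_ , x≡z)) = x≢z x≡z
      keep (inj₂ eq)        = unused _ eq

    covered : Covered R → Covered assigned
    covered cov d∉ e∉ v∈d v∈e = Sum.map₂ owned-old (cov d∉ e∉ v∈d v∈e)

  -- The new edge gets rank `clock`, so everything placed before may be its prey. It is itself free,
  -- because slots hold only placed vertices.
  module Place {todo} (R : Reservation todo) {e : E} (e∈ : e ∈ todo) where

    rank′ : E → ℕ
    rank′ d with d ≟ₑ e
    ... | yes _ = clock R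
    ... | no _  = rank R d

    rank′-new : rank′ e ≡ clock R
    rank′-new with e ≟ₑ e
    ... | yes _  = refl
    ... | no e≢e = contradiction refl e≢e

    rank′-old : ∀ {d} → d ∉ todo → rank′ d ≡ rank R d
    rank′-old {d} d∉ with d ≟ₑ e
    ... | yes refl = contradiction e∈ d∉
    ... | no _     = refl

    height′-old : ∀ x → PlacedX todo x → height rank′ x ≡ height (rank R) x
    height′-old (inj₁ d) d∉ = cong suc (rank′-old d∉)
    height′-old (inj₂ _) _  = refl

    older-new : ∀ {x} → PlacedX todo x → height rank′ x ≤ rank′ e
    older-new {x} placed = subst₂ _≤_ (sym (height′-old x placed)) (sym rank′-new) (bounded R placed)

    older-old : ∀ {x d} → PlacedX todo x → d ∉ todo → height (rank R) x ≤ rank R d → height rank′ x ≤ rank′ d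
    older-old {x} placed d∉ = subst₂ _≤_ (sym (height′-old x placed)) (sym (rank′-old d∉))

    placed : Reservation (todo ─ e)
    placed = record
      { rank = rank′ ; clock = suc (clock R) ; slot = slot R
      ; bounded = λ {x} → bounded′ x
      ; slot-placed = λ {_} {x} eq → placedX-─ x (slot-placed R eq)
      ; slot-inj = slot-inj R
      ; slot-older = λ eq d∉ → older′ eq (placed-─ d∉)
      }
      where
      bounded′ : ∀ x → PlacedX (todo ─ e) x → height rank′ x ≤ suc (clock R)
      bounded′ (inj₂ _) _ = z≤n
      bounded′ (inj₁ d) d∉ with placed-─ {todo} {e} {d} d∉
      ... | inj₁ refl = ℕ.≤-reflexive (cong suc rank′-new)
      ... | inj₂ d∉todo = ℕ.m≤n⇒m≤1+n (subst (_≤ clock R) (sym (height′-old (inj₁ d) d∉todo)) (bounded R d∉todo))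

      older′ : ∀ {v x d} → slot R v ≡ just x → d ≡ e ⊎ d ∉ todo → v ∈ₑ d → height rank′ x ≤ rank′ d
      older′ eq (inj₁ refl) _   = older-new (slot-placed R eq)
      older′ eq (inj₂ d∉)   v∈d = older-old (slot-placed R eq) d∉ (slot-older R eq d∉ v∈d)

    free-new : Free placed (inj₁ e)
    free-new = ∉-─ {todo} , λ v eq → slot-placed R eq e∈

    free-old : ∀ {x} → Free R x → Free placed x
    free-old {x} (x-placed , unused) = placedX-─ x x-placed , unused

    new≢old : ∀ {x} → PlacedX todo x → inj₁ e ≢ x
    new≢old e∉ refl = e∉ e∈

  -- The state between two placements. At most one vertex of `H`, the pending one, lies on placed
  -- and remaining edges without owning a slot, and `z₂` is kept old enough to become its slot.
  record TwoFree (todo : List E) : Set where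
    field
      reservation : Reservation todo
      z₁ z₂       : X
      z₁≢z₂       : z₁ ≢ z₂
      free₁       : Free reservation z₁
      free₂       : Free reservation z₂
      pending     : Maybe (Fin n)
      reserve     : ∀ {w} → pending ≡ just w → OlderThanStar reservation z₂ w
      covered     : Covered reservation
      open-ends   : ∀ {v d e} → d ∉ todo → e ∈ todo → v ∈ₑ d → v ∈ₑ e → Owned reservation v ⊎ pending ≡ just v

  record OneFree (todo : List E) : Set where
    field
      reservation : Reservation todo
      z           : X
      free        : Free reservation z
      covered     : Covered reservation
      open-ends   : ∀ {v d e} → d ∉ todo → e ∈ todo → v ∈ₑ d → v ∈ₑ e → Owned reservation v

  -- The reserved `z₂` is spent on the pending vertex, if there is one; `z₁` stays free.
  discharge : ∀ {todo} → TwoFree todo → OneFree todo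
  discharge {todo} S with TwoFree.pending S in eq
  ... | nothing = record
    { reservation = reservation ; z = z₁ ; free = free₁ ; covered = covered
    ; open-ends = λ d∉ e∈ v∈d v∈e → settled (open-ends d∉ e∈ v∈d v∈e)
    }
    where
    open TwoFree S
    settled : ∀ {v} → Owned reservation v ⊎ pending ≡ just v → Owned reservation v
    settled (inj₁ owned) = owned
    settled (inj₂ eq′) with () ← trans (sym eq) eq′
  ... | just w = record
    { reservation = A.assigned ; z = z₁ ; free = A.free-old z₁≢z₂ free₁ ; covered = A.covered covered
    ; open-ends = λ d∉ e∈ v∈d v∈e → settled (open-ends d∉ e∈ v∈d v∈e)
    }
    where
    open TwoFree S
    module A = Assign reservation w z₂ free₂ (reserve eq)
    settled : ∀ {v} → Owned reservation v ⊎ pending ≡ just v → Owned A.assigned v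
    settled (inj₁ owned) = A.owned-old owned
    settled (inj₂ eq′) with refl ← trans (sym eq) eq′ = A.owned-new

  -- The edge `e` itself becomes a second free vertex. At most its other end `b` lacks a slot, and
  -- `b` becomes pending instead of receiving one at once.
  extend : ∀ {todo} (S : OneFree todo) {e a} → e ∈ todo → a ∈ₑ e → Owned (OneFree.reservation S) a → TwoFree (todo ─ e)
  extend {todo} S {e} {a} e∈ a∈e a-owned with otherEnd e a∈e
  ... | b , b∈e , ends = result (owned? reservation b)
    where
    open OneFree S
    module P = Place reservation e∈

    covered′ : ∀ {v c d} → c ≡ e ⊎ c ∉ todo → d ≡ e ⊎ d ∉ todo → v ∈ₑ c → v ∈ₑ d → c ≡ d ⊎ Owned reservation v
    covered′ (inj₁ refl) (inj₁ refl) _   _   = inj₁ refl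
    -- Before `e` was placed, `v` lay on the placed edge `d` and the remaining edge `e`, so it
    -- already owned a slot.
    covered′ (inj₁ refl) (inj₂ d∉)   v∈e v∈d = inj₂ (open-ends d∉ e∈ v∈d v∈e)
    covered′ (inj₂ c∉)   (inj₁ refl) v∈c v∈e = inj₂ (open-ends c∉ e∈ v∈c v∈e)
    covered′ (inj₂ c∉)   (inj₂ d∉)   v∈c v∈d = covered c∉ d∉ v∈c v∈d

    result : Dec (Owned reservation b) → TwoFree (todo ─ e)
    result b-owned? = record
      -- `e` lies in the star of `b` and cannot be its prey, so the older `z` takes the place of
      -- `z₂`.
      { reservation = P.placed ; z₁ = inj₁ e ; z₂ = z ; z₁≢z₂ = P.new≢old (proj₁ free)
      ; free₁ = P.free-new ; free₂ = P.free-old free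
      ; pending = pending′ b-owned? ; reserve = λ eq d∉ → reserve′ b-owned? eq (placed-─ d∉)
      ; covered = λ c∉ d∉ → covered′ (placed-─ c∉) (placed-─ d∉)
      ; open-ends = λ c∉ d∈ v∈c v∈d → open-ends′ b-owned? (placed-─ c∉) (─-⊆ d∈) v∈c v∈d
      }
      where
      pending′ : Dec (Owned reservation b) → Maybe (Fin n)
      pending′ (yes _) = nothing
      pending′ (no _)  = just b

      reserve′ : ∀ b? {w d} → pending′ b? ≡ just w → d ≡ e ⊎ d ∉ todo → w ∈ₑ d → height P.rank′ z ≤ P.rank′ d
      reserve′ _            _    (inj₁ refl) _   = P.older-new (proj₁ free)
      -- An earlier edge at `b` would have forced a slot by `open-ends`, so `e` is the whole star of
      -- `b` so far.
      reserve′ (no ¬owned) refl (inj₂ d∉)   b∈d = contradiction (open-ends d∉ e∈ b∈d b∈e) ¬owned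

      open-ends′ : ∀ b? {v c d} → c ≡ e ⊎ c ∉ todo → d ∈ todo → v ∈ₑ c → v ∈ₑ d →
                   Owned reservation v ⊎ pending′ b? ≡ just v
      open-ends′ _  (inj₂ c∉) d∈ v∈c v∈d = inj₁ (open-ends c∉ d∈ v∈c v∈d)
      open-ends′ b? (inj₁ refl) d∈ v∈e v∈d with ends v∈e
      ... | inj₁ refl = inj₁ a-owned
      ... | inj₂ refl with b?
      ...   | yes owned = inj₁ owned
      ...   | no _      = inj₂ refl

  -- No remaining edge meets a placed one, so a pending vertex gets no further edges and its
  -- reservation lapses. Then `z₁` can open the star of an end of `e`, with `z₂` still free, and `e`
  -- has an owned end.
  restart : ∀ {todo} → TwoFree todo → ∀ {e} → e ∈ todo →
            (∀ {v d c} → d ∉ todo → c ∈ todo → v ∈ₑ d → ¬ v ∈ₑ c) → TwoFree (todo ─ e)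
  restart {todo} S {e} e∈ exhausted = extend opened e∈ a∈e A.owned-new
    where
    open TwoFree S
    a = Edge.lo e

    a∈e : a ∈ₑ e
    a∈e = inj₁ refl

    module A = Assign reservation a z₁ free₁ (λ d∉ a∈d → contradiction a∈e (exhausted d∉ e∈ a∈d))

    opened : OneFree todo
    opened = record
      { reservation = A.assigned ; z = z₂ ; free = A.free-old (z₁≢z₂ ∘ sym) free₂ ; covered = A.covered covered
      ; open-ends = λ d∉ c∈ v∈d v∈c → contradiction v∈c (exhausted d∉ c∈ v∈d)
      }

  step : ∀ {todo e} → e ∈ todo → TwoFree todo → ∃[ d ] (d ∈ todo × TwoFree (todo ─ d))
  step {todo} {e} e∈ S = choose (Any.any? (λ d → any? (λ v → (v ∈ₑ? d) ×-dec owned? reservation v)) todo)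
    where
    open OneFree (discharge S)

    OwnedEnd : E → Set
    OwnedEnd d = ∃[ v ] (v ∈ₑ d × Owned reservation v)

    choose : Dec (Any OwnedEnd todo) → ∃[ d ] (d ∈ todo × TwoFree (todo ─ d))
    choose (yes found) with d , d∈ , v , v∈d , owned ← find found = d , d∈ , extend (discharge S) d∈ v∈d owned
    -- By `open-ends` a remaining edge that met a placed one would have an owned end. The restart
    -- uses `S` before the discharge, while both of its vertices are unspent.
    choose (no none)   = e , e∈ , restart S e∈
      (λ d∉ c∈ v∈d v∈c → none (lose c∈ (_ , v∈c , open-ends d∉ c∈ v∈d v∈c)))

  ─-shorter : ∀ {todo e} → e ∈ todo → length (todo ─ e) < length todo
  ─-shorter {todo} {e} e∈ = List.filter-notAll (λ d → ¬? (d ≟ₑ e)) todo (lose e∈ λ e≢e → e≢e refl)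

  exhaust : ∀ m {todo} → length todo ≤ m → TwoFree todo → TwoFree []
  exhaust _       {[]}       _  S = S
  exhaust (suc m) {e ∷ todo} le S with step (here refl) S
  ... | d , d∈ , S′ = exhaust m (ℕ.≤-pred (ℕ.≤-trans (─-shorter d∈) le)) S′

  start : TwoFree (allEdges adj?)
  start = record
    { reservation = record
      { rank = λ _ → 0 ; clock = 0 ; slot = λ _ → nothing
      ; bounded = λ { {inj₁ e} e∉ → unplaced e∉ ; {inj₂ _} _ → z≤n }
      ; slot-placed = λ () ; slot-inj = λ () ; slot-older = λ () }
    ; z₁ = inj₂ zero ; z₂ = inj₂ (suc zero) ; z₁≢z₂ = λ ()
    ; free₁ = tt , λ _ () ; free₂ = tt , λ _ ()
    ; pending = nothing ; reserve = λ ()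
    ; covered = λ d∉ → unplaced d∉ ; open-ends = λ d∉ → unplaced d∉
    }
    where
    unplaced : ∀ {e} {A : Set} → e ∉ allEdges adj? → A
    unplaced e∉ = contradiction (∈-allEdges adj? _) e∉

  -- Each edge preys on the slots of its ends. No edge remains, so `λ ()` shows every edge to be
  -- placed, and `covered` then handles all adjacent pairs.
  lineGraph-realization : Realization (lineGraph H)
  lineGraph-realization = record
    { Prey     = λ e x → ∃[ v ] (v ∈ₑ e × slot reservation v ≡ just x)
    ; prey?    = λ e x → any? (λ v → (v ∈ₑ? e) ×-dec Maybe.≡-dec (Sum.≡-dec _≟ₑ_ _≟_) (slot reservation v) (just x))
    ; wf       = Subrelation.wellFounded (λ (v , v∈e , eq) → slot-older reservation eq (λ ()) v∈e)
                   (On.wellFounded (rank reservation) <-wellFounded)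
    ; complete = λ (d≢e , v , v∈d , v∈e) → common d≢e v∈d v∈e (covered (λ ()) (λ ()) v∈d v∈e)
    ; sound    = λ { {v = e} d≢e (v , v∈d , eq) (w , w∈e , eq′) →
                     d≢e , v , v∈d , subst (_∈ₑ e) (sym (slot-inj reservation eq eq′)) w∈e }
    }
    where
    open TwoFree (exhaust _ ≤-refl start)

    common : ∀ {v d e} → d ≢ e → v ∈ₑ d → v ∈ₑ e → d ≡ e ⊎ Owned reservation v →
             ∃[ x ] ((∃[ v ] (v ∈ₑ d × slot reservation v ≡ just x)) × (∃[ v ] (v ∈ₑ e × slot reservation v ≡ just x)))
    common d≢e _   _   (inj₁ d≡e)      = contradiction d≡e d≢e
    common _   v∈d v∈e (inj₂ (x , eq)) = x , (_ , v∈d , eq) , (_ , v∈e , eq)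

-- Assembly for generalized line graphs.

generalizedLineGraph≅attach : ∀ {n} (H : Graph (Fin n)) f →
  generalizedLineGraph H f ≅ attach (lineGraph H) _∈ₑ_ f
generalizedLineGraph≅attach H f = record
  { bijection = ↔-id _ ; preserves = λ u v → mk⇔ forth back }
  where
  forth : ∀ {u v} → GLAdj H f u v → AttachAdj (lineGraph H) _∈ₑ_ f u v
  forth (line de)             = base de
  forth (party {v} {p} {q} pq) = party {p = p} {q} pq
  forth (cross v∈e)           = cross v∈e
  forth (cross⁻¹ v∈e)         = cross⁻¹ v∈e

  back : ∀ {u v} → AttachAdj (lineGraph H) _∈ₑ_ f u v → GLAdj H f u v
  back (base de)              = line de
  back (party {v} {p} {q} pq) = party {p = p} {q} pq
  back (cross v∈e)            = cross v∈e
  back (cross⁻¹ v∈e)          = cross⁻¹ v∈e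

theorem1p2 : (G : FiniteGraph) → IsGeneralizedLineGraph G → ∃[ k ] (IsCompetitionNumber G k × k ≤ 2)
theorem1p2 G (H , f , G≅L) = competitionNumber-≤ G (realization⇒competition
  (transport G≅L (transport (generalizedLineGraph≅attach graph f)
    (attach-realization f _∈ₑ?_ star-clique lineGraph-realization))))
  where
  open FiniteGraph H
  open LineGraph adj?

  star-clique : ∀ v → IsClique (lineGraph graph) (v ∈ₑ_)
  star-clique v v∈d v∈e d≢e = d≢e , v , v∈d , v∈e
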